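{- Let $d\ge 1$ be an integer. The function $N\mapsto g_d(N)$, $N\in\mathbb{Z}_{\ge 0}$, is a polynomial in $N$ of degree $2d-2$.
   Context: Let $[d]=\{1,\dots,d\}$. A matrix $A\in\mathbb{R}^{d\times d}$ is a $G$-matrix of value $N\in\mathbb{R}_{\ge 0}$ if all its entries are nonnegative and $A_{1,\sigma(1)}+A_{2,\sigma(2)}+\cdots+A_{d,\sigma(d)}=N$ for every permutation $\sigma$ of $[d]$. For $N\in\mathbb{Z}_{\ge 0}$, $g_d(N)$ denotes the number of $d\times d$ $G$-matrices of value $N$ all of whose entries are integers. -}

module Defs where

open import Level using (0ℓ)
open import Data.Nat.Base as ℕ using (ℕ; suc)
open import Data.Integer.Base as ℤ using (ℤ; +_; 0ℤ)
import Data.Integer.Properties as ℤ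
open import Data.Rational.Base as ℚ using (ℚ; 0ℚ; _/_)
import Data.Rational.Properties as ℚ
open import Data.Fin.Base using (Fin; toℕ; fromℕ)
open import Data.Fin.Permutation using (Permutation′; _⟨$⟩ʳ_)
open import Data.Vec.Functional using (Vector)
import Data.Vec.Functional.Relation.Binary.Equality.Setoid as Pointwise
open import Data.Product.Base using (Σ; Σ-syntax; _×_; proj₁)
open import Relation.Binary.Bundles using (Setoid)
open import Relation.Binary.PropositionalEquality using (_≡_; _≢_; setoid)
import Relation.Binary.Construct.On as On
open import Function.Bundles using (Bijection)
open import Algebra.Bundles using (CommutativeRing)
open import Algebra.Properties.Monoid.Sum ℤ.+-0-monoid using () renaming (sum to sumℤ)
open import Algebra.Properties.Monoid.Sum ℚ.+-0-monoid using () renaming (sum to sumℚ)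
open import Algebra.Properties.Semiring.Exp
  (CommutativeRing.semiring ℚ.+-*-commutativeRing) using (_^_)

Matrix : ℕ → Set
Matrix d = Vector (Vector ℤ d) d

matrixSetoid : ℕ → Setoid 0ℓ 0ℓ
matrixSetoid d =
  Pointwise.≋-setoid (Pointwise.≋-setoid (setoid ℤ) d) d

record IsGMatrix {d : ℕ} (N : ℕ) (A : Matrix d) : Set where
  field
    nonNegative : ∀ i j → 0ℤ ℤ.≤ A i j
    permSum     : ∀ (σ : Permutation′ d) → sumℤ (λ i → A i (σ ⟨$⟩ʳ i)) ≡ + N

-- Two elements are equal when their entries are; the proofs of `IsGMatrix` are
-- ignored, so that each matrix is counted once.
gMatrixSetoid : (d N : ℕ) → Setoid 0ℓ 0ℓ
gMatrixSetoid d N =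
  On.setoid {B = Σ (Matrix d) (IsGMatrix N)} (matrixSetoid d) proj₁

HasCardinality : Setoid 0ℓ 0ℓ → ℕ → Set
HasCardinality S n = Bijection (setoid (Fin n)) S

-- `g` is the function g_d. Cardinalities are unique, so this determines `g`
-- pointwise.
CountsGMatrices : (d : ℕ) → (ℕ → ℕ) → Set
CountsGMatrices d g = ∀ N → HasCardinality (gMatrixSetoid d N) (g N)

eval : ∀ {m} → Vector ℚ m → ℚ → ℚ
eval c x = sumℚ (λ k → c k ℚ.* x ^ toℕ k)

-- Rational coefficients lose nothing: a real polynomial taking integer values
-- on ℕ has rational coefficients, by interpolation.
IsPolynomialOfDegree : ℕ → (ℕ → ℕ) → Set
IsPolynomialOfDegree n f =
  Σ[ c ∈ Vector ℚ (suc n) ]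
    (c (fromℕ n) ≢ 0ℚ × (∀ N → + f N / 1 ≡ eval c (+ N / 1)))

{-# OPTIONS --safe #-}
-- Comparing two permutations that differ by a transposition shows that every
-- G-matrix satisfies A i j + A k l ≡ A i l + A k j, hence
-- A i j ≡ a i + b j with a, b nonnegative; the pair (a , b) becomes unique once
-- some a i is required to vanish, and its total sum is then N. If i is the
-- position of the first zero of a, lowering the i positive entries before it
-- leaves 2d − 1 arbitrary naturals of sum N − i, so with k = 2d − 2
--   g_d(N) = Σ_{i<d} C(N + k − i, k),
-- a sum of polynomials in N of degree k, each with leading coefficient 1 / k!.
module Submission where

open import Data.Nat.Base using (ℕ; zero; suc; _+_; _*_; _∸_; _≤_; z≤n; s≤s; z<s)
open import Data.Nat.Properties
open import Data.Nat.Combinatorics using (_C_; nCn≡1; nC1≡n; k>n⇒nCk≡0; nCk+nC[k+1]≡[n+1]C[k+1])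
import Data.Nat.Solver as ℕ-Solver
open import Data.Integer.Base as ℤ using (∣_∣) renaming (+_ to pos)
import Data.Integer.Properties as ℤ
open import Data.Rational.Base as ℚ using (ℚ; 0ℚ; 1ℚ; _/_; Positive; toℚᵘ)
import Data.Rational.Properties as ℚ
import Data.Rational.Solver as ℚ-Solver
open import Data.Rational.Unnormalised.Base as ℚᵘ using (mkℚᵘ; *≡*)
import Data.Rational.Unnormalised.Properties as ℚᵘ
open import Data.Fin.Base using (Fin; zero; suc; toℕ; fromℕ; punchIn)
open import Data.Fin.Properties as Fin using (+↔⊎; toℕ<n; punchInᵢ≢i)
open import Data.Fin.Permutation
  using (Permutation′; _⟨$⟩ʳ_; transpose; lift₀; _∘ₚ_) renaming (id to idₚ)
open import Data.Vec.Base using (Vec; []; _∷_; foldr′; lookup; sum; tabulate)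
open import Data.Vec.Properties using (lookup∘tabulate; tabulate∘lookup; tabulate-cong)
open import Data.Vec.Functional as Vector using (Vector; head; tail; removeAt)
open import Data.Product.Base
  using (Σ; Σ-syntax; ∃; _×_; _,_; proj₁; proj₂)
open import Data.Sum.Base using (_⊎_; inj₁; inj₂)
open import Data.Sum.Function.Propositional using (_⊎-↔_)
open import Function.Base using (_∘_)
open import Function.Bundles using (Bijection; _↔_; mk↔ₛ′)
open import Function.Construct.Composition using (_↔-∘_; bijection)
open import Function.Construct.Identity using (↔-id)
open import Function.Properties.Inverse using (↔⇒⤖)
open import Relation.Nullary.Decidable using (yes; no; dec-true; dec-false)
open import Relation.Binary.PropositionalEquality
open import Algebra.Bundles using (CommutativeRing)
open import Algebra.Properties.CommutativeSemigroup +-commutativeSemigroup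
  using (xy∙z≈y∙xz; xy∙z≈xz∙y; x∙yz≈y∙xz)
open import Algebra.Properties.CommutativeMonoid.Sum +-0-commutativeMonoid
  using (sum-remove; sum-permute; ∑-distrib-+)
  renaming (sum to ∑; sum-cong-≗ to ∑-cong; sum-replicate-zero to ∑-zero)
open import Algebra.Properties.Monoid.Sum ℤ.+-0-monoid
  using () renaming (sum to ∑ℤ; sum-cong-≗ to ∑ℤ-cong)
open CommutativeRing ℚ.+-*-commutativeRing using (semiring)
open import Algebra.Properties.Semiring.Sum semiring using ()
  renaming (sum-cong-≗ to ∑ℚ-cong; *-distribˡ-sum to *-distribˡ-∑ℚ; ∑-distrib-+ to ∑ℚ-distrib-+)
open import Algebra.Properties.Semiring.Exp semiring using (_^_)
open import Defs

-- Counting normalised pairs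

product : ∀ {n} → Vec ℕ n → ℕ
product = foldr′ _*_ 1

-- Weak compositions: entries may be zero and their order matters.
Comp : ℕ → ℕ → Set
Comp n N = Σ[ v ∈ Vec ℕ n ] sum v ≡ N

-- A weak composition cut into two blocks. Keeping the blocks apart lets entries move from one to
-- the other without casts between vector lengths.
PairComp : ℕ → ℕ → ℕ → Set
PairComp m n N = Σ[ a ∈ Vec ℕ m ] Σ[ b ∈ Vec ℕ n ] sum a + sum b ≡ N

-- The existence of a zero entry of a is encoded as product a ≡ 0, which has at
-- most one proof, so that a pair is counted once.
NormalPair : ℕ → ℕ → ℕ → Set
NormalPair m n N =
  Σ[ a ∈ Vec ℕ m ] Σ[ b ∈ Vec ℕ n ] (product a ≡ 0 × sum a + sum b ≡ N)

Comp-≡ : ∀ {n N} {x y : Comp n N} → proj₁ x ≡ proj₁ y → x ≡ y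
Comp-≡ {x = v , p} {y = .v , q} refl = cong (v ,_) (≡-irrelevant p q)

PairComp-≡ : ∀ {m n N} {x y : PairComp m n N} →
  proj₁ x ≡ proj₁ y → proj₁ (proj₂ x) ≡ proj₁ (proj₂ y) → x ≡ y
PairComp-≡ {x = a , b , p} {y = .a , .b , q} refl refl =
  cong (λ r → a , b , r) (≡-irrelevant p q)

NormalPair-≡ : ∀ {m n N} {x y : NormalPair m n N} →
  proj₁ x ≡ proj₁ y → proj₁ (proj₂ x) ≡ proj₁ (proj₂ y) → x ≡ y
NormalPair-≡ {x = a , b , z , p} {y = .a , .b , w , q} refl refl =
  cong₂ (λ r s → a , b , r , s) (≡-irrelevant z w) (≡-irrelevant p q)

Comp-zero : ∀ n → Comp n 0 ↔ Comp (suc n) 0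
Comp-zero n = mk↔ₛ′ (λ (v , p) → 0 ∷ v , p) (λ { (0 ∷ v , p) → v , p })
  (λ { (0 ∷ v , p) → refl }) (λ (v , p) → refl)

-- Pascal's rule as a bijection: a first entry 0 is dropped, a positive one is lowered by one.
Comp-suc : ∀ n N → (Comp n (suc N) ⊎ Comp (suc n) N) ↔ Comp (suc n) (suc N)
Comp-suc n N = mk↔ₛ′ to from to∘from from∘to
  where
  to : Comp n (suc N) ⊎ Comp (suc n) N → Comp (suc n) (suc N)
  to (inj₁ (v , p))     = 0 ∷ v , p
  to (inj₂ (x ∷ v , p)) = suc x ∷ v , cong suc p

  from : Comp (suc n) (suc N) → Comp n (suc N) ⊎ Comp (suc n) N
  from (0 ∷ v , p)     = inj₁ (v , p)
  from (suc x ∷ v , p) = inj₂ (x ∷ v , suc-injective p)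

  to∘from : ∀ v → to (from v) ≡ v
  to∘from (0 ∷ v , p)     = refl
  to∘from (suc x ∷ v , p) = Comp-≡ refl

  from∘to : ∀ v → from (to v) ≡ v
  from∘to (inj₁ (v , p))     = refl
  from∘to (inj₂ (x ∷ v , p)) = cong inj₂ (Comp-≡ refl)

PairComp-zero : ∀ n N → Comp n N ↔ PairComp 0 n N
PairComp-zero n N = mk↔ₛ′ (λ (b , p) → [] , b , p) (λ { ([] , b , p) → b , p })
  (λ { ([] , b , p) → refl }) (λ (b , p) → refl)

PairComp-suc : ∀ m n N → PairComp m (suc n) N ↔ PairComp (suc m) n N
PairComp-suc m n N = mk↔ₛ′
  (λ { (a , x ∷ b , p) → x ∷ a , b , trans (xy∙z≈y∙xz x (sum a) (sum b)) p })
  (λ { (x ∷ a , b , p) → a , x ∷ b , trans (sym (xy∙z≈y∙xz x (sum a) (sum b))) p })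
  (λ { (x ∷ a , b , p) → PairComp-≡ refl refl })
  (λ { (a , x ∷ b , p) → PairComp-≡ refl refl })

-- Total 0 forces the first entry of `a` to be 0; the product then vanishes and the other entries
-- carry no further condition.
NormalPair-zero : ∀ m n → PairComp m n 0 ↔ NormalPair (suc m) n 0
NormalPair-zero m n = mk↔ₛ′
  (λ (a , b , p) → 0 ∷ a , b , refl , p)
  (λ { (0 ∷ a , b , z , p) → a , b , p })
  (λ { (0 ∷ a , b , z , p) → NormalPair-≡ refl refl })
  (λ (a , b , p) → refl)

-- A positive first entry of a is lowered by one and moved to b, where it is
-- unconstrained.
NormalPair-suc : ∀ m n N →
  (PairComp m n (suc N) ⊎ NormalPair m (suc n) N) ↔ NormalPair (suc m) n (suc N)
NormalPair-suc m n N = mk↔ₛ′ to from to∘from from∘to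
  where
  to : PairComp m n (suc N) ⊎ NormalPair m (suc n) N → NormalPair (suc m) n (suc N)
  to (inj₁ (a , b , p)) = 0 ∷ a , b , refl , p
  to (inj₂ (a , x ∷ b , z , p)) =
    suc x ∷ a , b , trans (cong (suc x *_) z) (*-zeroʳ (suc x)) ,
    cong suc (trans (xy∙z≈y∙xz x (sum a) (sum b)) p)

  from : NormalPair (suc m) n (suc N) → PairComp m n (suc N) ⊎ NormalPair m (suc n) N
  from (0 ∷ a , b , z , p)     = inj₁ (a , b , p)
  from (suc x ∷ a , b , z , p) =
    inj₂ (a , x ∷ b , m+n≡0⇒m≡0 (product a) z ,
          trans (sym (xy∙z≈y∙xz x (sum a) (sum b))) (suc-injective p))

  to∘from : ∀ v → to (from v) ≡ v
  to∘from (0 ∷ a , b , z , p)     = NormalPair-≡ refl refl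
  to∘from (suc x ∷ a , b , z , p) = NormalPair-≡ refl refl

  from∘to : ∀ v → from (to v) ≡ v
  from∘to (inj₁ (a , b , p))         = refl
  from∘to (inj₂ (a , x ∷ b , z , p)) = cong inj₂ (NormalPair-≡ refl refl)

-- Cardinalities as sums of binomial coefficients.

Fin-cong : ∀ {m n} → m ≡ n → Fin m ↔ Fin n
Fin-cong refl = ↔-id _

-- Stars and bars: `N` stars and `k` bars separating `suc k` entries. The induction is Pascal's
-- rule.
|Comp| : ∀ k N → Fin ((N + k) C k) ↔ Comp (suc k) N
|Comp| zero N = mk↔ₛ′ (λ _ → N ∷ [] , +-identityʳ N) (λ _ → zero)
  (λ { (x ∷ [] , p) → unique x (trans (sym p) (+-identityʳ x)) p }) (λ { zero → refl })
  where
  unique : ∀ x → N ≡ x → (p : x + 0 ≡ N) → (N ∷ [] , +-identityʳ N) ≡ (x ∷ [] , p)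
  unique x refl p = Comp-≡ refl
|Comp| (suc k) zero =
  Comp-zero (suc k) ↔-∘ (|Comp| k 0 ↔-∘ Fin-cong (trans (nCn≡1 (suc k)) (sym (nCn≡1 k))))
|Comp| (suc k) (suc N) =
  Comp-suc (suc k) N ↔-∘ ((|Comp| k (suc N) ⊎-↔ |Comp| (suc k) N) ↔-∘ (+↔⊎ ↔-∘ Fin-cong pascal))
  where
  pascal : (suc N + suc k) C suc k ≡ (suc N + k) C k + (N + suc k) C suc k
  pascal = trans (sym (nCk+nC[k+1]≡[n+1]C[k+1] (N + suc k) k))
                 (cong (λ n → n C k + (N + suc k) C suc k) (+-suc N k))

-- Only the total number of entries matters, so the entries of `a` are moved to `b` one at a time.
|PairComp| : ∀ m {n} k N → m + n ≡ suc k → Fin ((N + k) C k) ↔ PairComp m n N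
|PairComp| zero    k N refl = PairComp-zero _ N ↔-∘ |Comp| k N
|PairComp| (suc m) k N eq   =
  PairComp-suc m _ N ↔-∘ |PairComp| m k N (trans (+-suc m _) eq)

-- Follows the search for the first zero of `a`: each positive entry passed uses up one entry of `a`
-- and one unit of `N`. The value at `N = 0` is written `k C k` instead of 1 to match `|PairComp|`
-- at 0 definitionally.
count : ℕ → ℕ → ℕ → ℕ
count zero    k N       = 0
count (suc m) k zero    = k C k
count (suc m) k (suc N) = (suc N + k) C k + count m k N

|NormalPair| : ∀ m {n} k N → m + n ≡ suc (suc k) → Fin (count m k N) ↔ NormalPair m n N
-- The empty product is 1, so an empty `a` admits no pair.
|NormalPair| zero k N eq = mk↔ₛ′ (λ ()) (λ { ([] , _ , () , _) }) (λ { ([] , _ , () , _) }) (λ ())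
|NormalPair| (suc m) {n} k zero eq =
  NormalPair-zero m n ↔-∘ |PairComp| m k 0 (suc-injective eq)
|NormalPair| (suc m) {n} k (suc N) eq =
  NormalPair-suc m n N ↔-∘
    ((|PairComp| m k (suc N) (suc-injective eq)
      ⊎-↔ |NormalPair| m k N (trans (+-suc m n) eq))
     ↔-∘ +↔⊎)

-- The recursion may stop early when `N` runs out, whereas the sum always has `m` terms; the surplus
-- ones vanish, their upper index being below `k`. The bound on `m` keeps the truncated subtraction
-- `k ∸ suc i` exact there.
count-closed : ∀ m k N → m ≤ suc k → count m k N ≡ ∑ {m} (λ i → (N + k ∸ toℕ i) C k)
count-closed zero    k N       _         = refl
count-closed (suc m) k (suc N) (s≤s m≤k) = cong (_ +_) (count-closed m k N (m≤n⇒m≤1+n m≤k))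
count-closed (suc m) k zero    (s≤s m≤k) = sym (trans
  (cong (k C k +_) (trans (∑-cong vanish) (∑-zero m))) (+-identityʳ (k C k)))
  where
  vanish : ∀ (i : Fin m) → (k ∸ suc (toℕ i)) C k ≡ 0
  vanish i = k>n⇒nCk≡0 (∸-monoʳ-< z<s (≤-trans (toℕ<n i) m≤k))

-- Polynomials over ℚ

ι : ℕ → ℚ
ι n = pos n / 1

toℚᵘ-ι : ∀ n → toℚᵘ (ι n) ℚᵘ.≃ mkℚᵘ (pos n) 0
toℚᵘ-ι n = ℚ.toℚᵘ-fromℚᵘ (mkℚᵘ (pos n) 0)

-- Arithmetic in ℚ normalises by a gcd, so the identity is checked on unnormalised fractions with
-- denominator 1.
ι-+ : ∀ m n → ι (m + n) ≡ ι m ℚ.+ ι n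
ι-+ m n = ℚ.toℚᵘ-injective (begin
  toℚᵘ (ι (m + n))                   ≈⟨ toℚᵘ-ι (m + n) ⟩
  mkℚᵘ (pos (m + n)) 0               ≈⟨ *≡* (cong (ℤ._* pos 1) (sym over-1)) ⟩
  mkℚᵘ (pos m) 0 ℚᵘ.+ mkℚᵘ (pos n) 0   ≈⟨ ℚᵘ.+-cong (toℚᵘ-ι m) (toℚᵘ-ι n) ⟨
  toℚᵘ (ι m) ℚᵘ.+ toℚᵘ (ι n)           ≈⟨ ℚ.toℚᵘ-homo-+ (ι m) (ι n) ⟨
  toℚᵘ (ι m ℚ.+ ι n)                 ∎)
  where
  open ℚᵘ.≃-Reasoning
  over-1 : pos m ℤ.* pos 1 ℤ.+ pos n ℤ.* pos 1 ≡ pos (m + n)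
  over-1 = cong₂ ℤ._+_ (ℤ.*-identityʳ (pos m)) (ℤ.*-identityʳ (pos n))

ι-* : ∀ m n → ι (m * n) ≡ ι m ℚ.* ι n
ι-* m n = ℚ.toℚᵘ-injective (begin
  toℚᵘ (ι (m * n))                   ≈⟨ toℚᵘ-ι (m * n) ⟩
  mkℚᵘ (pos (m * n)) 0               ≈⟨ *≡* (cong (ℤ._* pos 1) (ℤ.pos-* m n)) ⟩
  mkℚᵘ (pos m) 0 ℚᵘ.* mkℚᵘ (pos n) 0   ≈⟨ ℚᵘ.*-cong (toℚᵘ-ι m) (toℚᵘ-ι n) ⟨
  toℚᵘ (ι m) ℚᵘ.* toℚᵘ (ι n)           ≈⟨ ℚ.toℚᵘ-homo-* (ι m) (ι n) ⟨
  toℚᵘ (ι m ℚ.* ι n)                 ∎)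
  where open ℚᵘ.≃-Reasoning

ι-suc-pos : ∀ n → Positive (ι (suc n))
ι-suc-pos n = ℚ.normalize-pos (suc n) 1

-- Horner's rule, the form of evaluation suited to induction on the coefficients.
eval-∷ : ∀ {m} (c : Vector ℚ (suc m)) x → eval c x ≡ head c ℚ.+ x ℚ.* eval (tail c) x
eval-∷ {m} c x = cong₂ ℚ._+_ (ℚ.*-identityʳ (head c))
  (trans (∑ℚ-cong (λ k → shift (tail c k) (x ^ toℕ k)))
         (sym (*-distribˡ-∑ℚ x (λ k → tail c k ℚ.* x ^ toℕ k))))
  where
  shift : ∀ u v → u ℚ.* (x ℚ.* v) ≡ x ℚ.* (u ℚ.* v)
  shift u v = solve 3 (λ x u v → u :* (x :* v) := x :* (u :* v)) refl x u v
    where open ℚ-Solver.+-*-Solver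

eval-+ : ∀ {m} (c d : Vector ℚ m) x → eval (λ k → c k ℚ.+ d k) x ≡ eval c x ℚ.+ eval d x
eval-+ c d x = trans (∑ℚ-cong (λ k → ℚ.*-distribʳ-+ (x ^ toℕ k) (c k) (d k)))
  (∑ℚ-distrib-+ (λ k → c k ℚ.* x ^ toℕ k) (λ k → d k ℚ.* x ^ toℕ k))

-- The coefficients of z + (q x + r) c(x).
mulLinear : ∀ {m} → ℚ → ℚ → ℚ → Vector ℚ m → Vector ℚ (suc m)
mulLinear {zero}  q r z c = λ _ → z
mulLinear {suc m} q r z c = (z ℚ.+ r ℚ.* head c) Vector.∷ mulLinear q r (q ℚ.* head c) (tail c)

-- The accumulator `z` is what makes the induction close: the part `q x` of the factor sends the
-- head coefficient one degree up, where it enters the tail as the new constant.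
eval-mulLinear : ∀ {m} q r z (c : Vector ℚ m) x →
  eval (mulLinear q r z c) x ≡ z ℚ.+ (q ℚ.* x ℚ.+ r) ℚ.* eval c x
eval-mulLinear {zero}  q r z c x = solve 4
  (λ q r z x → z :* con 1ℚ :+ con 0ℚ := z :+ (q :* x :+ r) :* con 0ℚ) refl q r z x
  where open ℚ-Solver.+-*-Solver
eval-mulLinear {suc m} q r z c x = begin
  eval (mulLinear q r z c) x
    ≡⟨ eval-∷ (mulLinear q r z c) x ⟩
  (z ℚ.+ r ℚ.* head c) ℚ.+ x ℚ.* eval (mulLinear q r (q ℚ.* head c) (tail c)) x
    ≡⟨ cong (λ e → (z ℚ.+ r ℚ.* head c) ℚ.+ x ℚ.* e) (eval-mulLinear q r (q ℚ.* head c) (tail c) x) ⟩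
  (z ℚ.+ r ℚ.* head c) ℚ.+ x ℚ.* (q ℚ.* head c ℚ.+ (q ℚ.* x ℚ.+ r) ℚ.* eval (tail c) x)
    ≡⟨ regroup q r z (head c) x (eval (tail c) x) ⟩
  z ℚ.+ (q ℚ.* x ℚ.+ r) ℚ.* (head c ℚ.+ x ℚ.* eval (tail c) x)
    ≡⟨ cong (λ e → z ℚ.+ (q ℚ.* x ℚ.+ r) ℚ.* e) (eval-∷ c x) ⟨
  z ℚ.+ (q ℚ.* x ℚ.+ r) ℚ.* eval c x ∎
  where
  open ≡-Reasoning
  regroup : ∀ q r z c₀ x e →
    (z ℚ.+ r ℚ.* c₀) ℚ.+ x ℚ.* (q ℚ.* c₀ ℚ.+ (q ℚ.* x ℚ.+ r) ℚ.* e) ≡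
    z ℚ.+ (q ℚ.* x ℚ.+ r) ℚ.* (c₀ ℚ.+ x ℚ.* e)
  regroup = solve 6 (λ q r z c₀ x e →
    (z :+ r :* c₀) :+ x :* (q :* c₀ :+ (q :* x :+ r) :* e) :=
    z :+ (q :* x :+ r) :* (c₀ :+ x :* e)) refl
    where open ℚ-Solver.+-*-Solver

-- The last carry meets an exhausted vector and becomes the top coefficient, with nothing added to
-- it.
mulLinear-leading : ∀ n q r z (c : Vector ℚ (suc n)) →
  mulLinear q r z c (fromℕ (suc n)) ≡ q ℚ.* c (fromℕ n)
mulLinear-leading zero    q r z c = refl
mulLinear-leading (suc n) q r z c = mulLinear-leading n q r (q ℚ.* head c) (tail c)

-- Unlike a nonzero leading coefficient, a positive one survives addition.
record PositivePolynomial (n : ℕ) (f : ℕ → ℕ) : Set where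
  constructor mk
  field
    coeffs      : Vector ℚ (suc n)
    leading-pos : Positive (coeffs (fromℕ n))
    evaluates   : ∀ N → ι (f N) ≡ eval coeffs (ι N)

PositivePolynomial⇒IsPolynomialOfDegree : ∀ {n f} →
  PositivePolynomial n f → IsPolynomialOfDegree n f
PositivePolynomial⇒IsPolynomialOfDegree {n} (mk c c-pos eq) =
  c , (λ c≡0 → ℚ.<-irrefl (sym c≡0) (ℚ.positive⁻¹ (c (fromℕ n)) {{c-pos}})) , eq

PositivePolynomial-resp : ∀ {n f g} → (∀ N → f N ≡ g N) →
  PositivePolynomial n f → PositivePolynomial n g
PositivePolynomial-resp f≗g (mk c c-pos eq) =
  mk c c-pos λ N → trans (cong ι (sym (f≗g N))) (eq N)

PositivePolynomial-one : PositivePolynomial 0 (λ _ → 1)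
PositivePolynomial-one = mk (λ _ → 1ℚ) _ (λ _ → refl)

PositivePolynomial-+ : ∀ {n f g} → PositivePolynomial n f → PositivePolynomial n g →
  PositivePolynomial n (λ N → f N + g N)
PositivePolynomial-+ {n} {f} {g} (mk c c-pos c-eq) (mk d d-pos d-eq) =
  mk (λ k → c k ℚ.+ d k)
  (ℚ.pos+pos⇒pos (c (fromℕ n)) {{c-pos}} (d (fromℕ n)) {{d-pos}})
  λ N → trans (ι-+ (f N) (g N))
          (trans (cong₂ ℚ._+_ (c-eq N) (d-eq N)) (sym (eval-+ c d (ι N))))

-- The index set is nonempty because an empty sum is the zero function, which has no positive
-- leading coefficient.
PositivePolynomial-∑ : ∀ {n} m (f : Fin (suc m) → ℕ → ℕ) →
  (∀ i → PositivePolynomial n (f i)) → PositivePolynomial n (λ N → ∑ (λ i → f i N))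
PositivePolynomial-∑ zero    f pp =
  PositivePolynomial-resp (λ N → sym (+-identityʳ (f zero N))) (pp zero)
PositivePolynomial-∑ (suc m) f pp =
  PositivePolynomial-+ (pp zero) (PositivePolynomial-∑ m (f ∘ suc) (pp ∘ suc))

-- The function `g` is given by its values in ℚ, since the linear factor need not take natural
-- values.
PositivePolynomial-mulLinear : ∀ {n f g} q r → Positive q →
  (∀ N → ι (g N) ≡ (q ℚ.* ι N ℚ.+ r) ℚ.* ι (f N)) →
  PositivePolynomial n f → PositivePolynomial (suc n) g
PositivePolynomial-mulLinear {n} q r q-pos g-eq (mk c c-pos eq) =
  mk (mulLinear q r 0ℚ c)
  (subst Positive (sym (mulLinear-leading n q r 0ℚ c))
    (ℚ.pos*pos⇒pos q {{q-pos}} (c (fromℕ n)) {{c-pos}}))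
  λ N → trans (g-eq N) (trans (cong ((q ℚ.* ι N ℚ.+ r) ℚ.*_) (eq N))
    (sym (trans (eval-mulLinear q r 0ℚ c (ι N)) (ℚ.+-identityˡ _))))

-- (k + 1) C(n, k + 1) = (n − k) C(n, k), without a subtraction so that it also
-- holds for n < k.
C-suc : ∀ n k → suc k * (n C suc k) + k * (n C k) ≡ n * (n C k)
C-suc zero zero = refl
C-suc zero (suc k) = cong₂ _+_ (*-zeroʳ (suc (suc k))) (*-zeroʳ (suc k))
C-suc (suc n) zero = trans (cong (λ c → 1 * c + 0) (nC1≡n (suc n)))
  (solve 1 (λ n → con 1 :* (con 1 :+ n) :+ con 0 := (con 1 :+ n) :* con 1) refl n)
  where open ℕ-Solver.+-*-Solver
C-suc (suc n) (suc k) = begin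
  suc (suc k) * (suc n C suc (suc k)) + suc k * (suc n C suc k)
    ≡⟨ cong₂ (λ u v → suc (suc k) * u + suc k * v) (pascal (suc k)) (pascal k) ⟩
  suc (suc k) * (c₁ + c₂) + suc k * (c₀ + c₁)
    ≡⟨ regroup₁ k c₀ c₁ c₂ ⟩
  (suc (suc k) * c₂ + suc k * c₁) + (suc k * c₁ + k * c₀) + (c₀ + c₁)
    ≡⟨ cong₂ (λ u v → u + v + (c₀ + c₁)) (C-suc n (suc k)) (C-suc n k) ⟩
  n * c₁ + n * c₀ + (c₀ + c₁)
    ≡⟨ regroup₂ n c₀ c₁ ⟩
  suc n * (c₀ + c₁)
    ≡⟨ cong (suc n *_) (pascal k) ⟨
  suc n * (suc n C suc k) ∎
  where
  open ≡-Reasoning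
  c₀ = n C k
  c₁ = n C suc k
  c₂ = n C suc (suc k)
  pascal : ∀ j → suc n C suc j ≡ n C j + n C suc j
  pascal j = sym (nCk+nC[k+1]≡[n+1]C[k+1] n j)
  regroup₁ : ∀ k c₀ c₁ c₂ →
    suc (suc k) * (c₁ + c₂) + suc k * (c₀ + c₁) ≡
    (suc (suc k) * c₂ + suc k * c₁) + (suc k * c₁ + k * c₀) + (c₀ + c₁)
  regroup₁ = solve 4 (λ k c₀ c₁ c₂ →
    (con 2 :+ k) :* (c₁ :+ c₂) :+ (con 1 :+ k) :* (c₀ :+ c₁) :=
    ((con 2 :+ k) :* c₂ :+ (con 1 :+ k) :* c₁) :+ ((con 1 :+ k) :* c₁ :+ k :* c₀) :+ (c₀ :+ c₁)) refl
    where open ℕ-Solver.+-*-Solver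
  regroup₂ : ∀ n c₀ c₁ → n * c₁ + n * c₀ + (c₀ + c₁) ≡ suc n * (c₀ + c₁)
  regroup₂ = solve 3 (λ n c₀ c₁ →
    n :* c₁ :+ n :* c₀ :+ (c₀ :+ c₁) := (con 1 :+ n) :* (c₀ :+ c₁)) refl
    where open ℕ-Solver.+-*-Solver

-- Induction on `k` by C(N + e, k + 1) = (N + e - k) / (k + 1) · C(N + e, k): each step multiplies
-- by a linear factor of slope 1 / (k + 1).
C-PositivePolynomial : ∀ k e → PositivePolynomial k (λ N → (N + e) C k)
C-PositivePolynomial zero    e = PositivePolynomial-one
C-PositivePolynomial (suc k) e =
  PositivePolynomial-mulLinear q (q ℚ.* (ι e ℚ.- ι k)) q-pos recurrence (C-PositivePolynomial k e)
  where
  s-pos : Positive (ι (suc k))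
  s-pos = ι-suc-pos k
  s≢0 : ℚ.NonZero (ι (suc k))
  s≢0 = ℚ.pos⇒nonZero (ι (suc k)) {{s-pos}}
  q : ℚ
  q = ℚ.1/_ (ι (suc k)) {{s≢0}}
  q-pos : Positive q
  q-pos = ℚ.1/pos⇒pos (ι (suc k)) {{s-pos}}
  recurrence : ∀ N → ι ((N + e) C suc k) ≡
    (q ℚ.* ι N ℚ.+ q ℚ.* (ι e ℚ.- ι k)) ℚ.* ι ((N + e) C k)
  recurrence N = begin
    c₁                                        ≡⟨ ℚ.*-identityˡ c₁ ⟨
    1ℚ ℚ.* c₁                                 ≡⟨ cong (ℚ._* c₁) (ℚ.*-inverseˡ s {{s≢0}}) ⟨
    -- The term with `ι k` is added and subtracted to produce the left side of `C-suc`.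
    q ℚ.* s ℚ.* c₁                            ≡⟨ regroup₁ q s c₁ (ι k) c₀ ⟩
    q ℚ.* (s ℚ.* c₁ ℚ.+ ι k ℚ.* c₀) ℚ.- q ℚ.* ι k ℚ.* c₀
      ≡⟨ cong (λ u → q ℚ.* u ℚ.- q ℚ.* ι k ℚ.* c₀) C-suc-ℚ ⟩
    q ℚ.* ((ι N ℚ.+ ι e) ℚ.* c₀) ℚ.- q ℚ.* ι k ℚ.* c₀
      ≡⟨ regroup₂ q (ι N) (ι e) (ι k) c₀ ⟩
    (q ℚ.* ι N ℚ.+ q ℚ.* (ι e ℚ.- ι k)) ℚ.* c₀ ∎
    where
    open ≡-Reasoning
    s = ι (suc k)
    c₀ = ι ((N + e) C k)
    c₁ = ι ((N + e) C suc k)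
    C-suc-ℚ : s ℚ.* c₁ ℚ.+ ι k ℚ.* c₀ ≡ (ι N ℚ.+ ι e) ℚ.* c₀
    C-suc-ℚ = begin
      s ℚ.* c₁ ℚ.+ ι k ℚ.* c₀
        ≡⟨ cong₂ ℚ._+_ (ι-* (suc k) ((N + e) C suc k)) (ι-* k ((N + e) C k)) ⟨
      ι (suc k * ((N + e) C suc k)) ℚ.+ ι (k * ((N + e) C k))
        ≡⟨ ι-+ (suc k * ((N + e) C suc k)) (k * ((N + e) C k)) ⟨
      ι (suc k * ((N + e) C suc k) + k * ((N + e) C k))
        ≡⟨ cong ι (C-suc (N + e) k) ⟩
      ι ((N + e) * ((N + e) C k))
        ≡⟨ ι-* (N + e) ((N + e) C k) ⟩
      ι (N + e) ℚ.* c₀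
        ≡⟨ cong (ℚ._* c₀) (ι-+ N e) ⟩
      (ι N ℚ.+ ι e) ℚ.* c₀ ∎
    open ℚ-Solver.+-*-Solver
    regroup₁ : ∀ q s c₁ κ c₀ →
      q ℚ.* s ℚ.* c₁ ≡ q ℚ.* (s ℚ.* c₁ ℚ.+ κ ℚ.* c₀) ℚ.- q ℚ.* κ ℚ.* c₀
    regroup₁ = solve 5 (λ q s c₁ κ c₀ →
      q :* s :* c₁ := q :* (s :* c₁ :+ κ :* c₀) :- q :* κ :* c₀) refl
    regroup₂ : ∀ q n e κ c₀ →
      q ℚ.* ((n ℚ.+ e) ℚ.* c₀) ℚ.- q ℚ.* κ ℚ.* c₀ ≡
      (q ℚ.* n ℚ.+ q ℚ.* (e ℚ.- κ)) ℚ.* c₀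
    regroup₂ = solve 5 (λ q n e κ c₀ →
      q :* ((n :+ e) :* c₀) :- q :* κ :* c₀ := (q :* n :+ q :* (e :- κ)) :* c₀) refl

-- G-matrices as sums of a row and a column

∑ℤ-pos : ∀ {n} (f : Vector ℕ n) → ∑ℤ (λ i → pos (f i)) ≡ pos (∑ f)
∑ℤ-pos {zero}  f = refl
∑ℤ-pos {suc n} f = cong (λ z → pos (f zero) ℤ.+ z) (∑ℤ-pos (f ∘ suc))

∑-lookup : ∀ {n} (v : Vec ℕ n) → ∑ (lookup v) ≡ sum v
∑-lookup []      = refl
∑-lookup (x ∷ v) = cong (x +_) (∑-lookup v)

-- A permutation merely rearranges the terms of `b`. Hence every matrix with entries a i + b j has
-- equal permutation sums.
∑-rank-one : ∀ {n} (a b : Vector ℕ n) (σ : Permutation′ n) →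
  ∑ (λ i → a i + b (σ ⟨$⟩ʳ i)) ≡ ∑ a + ∑ b
∑-rank-one a b σ = trans (∑-distrib-+ a (λ i → b (σ ⟨$⟩ʳ i)))
  (cong (∑ a +_) (sym (sum-permute b σ)))

sum-tabulate : ∀ {n} (f : Vector ℕ n) → sum (tabulate f) ≡ ∑ f
sum-tabulate {zero}  f = refl
sum-tabulate {suc n} f = cong (f zero +_) (sum-tabulate (f ∘ suc))

product≡0⇒∃ : ∀ {n} (v : Vec ℕ n) → product v ≡ 0 → ∃ λ i → lookup v i ≡ 0
product≡0⇒∃ (x ∷ v) p with m*n≡0⇒m≡0∨n≡0 x p
... | inj₁ x≡0 = zero , x≡0
... | inj₂ q   = let i , vᵢ≡0 = product≡0⇒∃ v q in suc i , vᵢ≡0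

∃⇒product≡0 : ∀ {n} (v : Vec ℕ n) i → lookup v i ≡ 0 → product v ≡ 0
∃⇒product≡0 (x ∷ v) zero    refl = refl
∃⇒product≡0 (x ∷ v) (suc i) p    = trans (cong (x *_) (∃⇒product≡0 v i p)) (*-zeroʳ x)

lookup-injective : ∀ {n} (u v : Vec ℕ n) → (∀ i → lookup u i ≡ lookup v i) → u ≡ v
lookup-injective u v eq =
  trans (sym (tabulate∘lookup u)) (trans (tabulate-cong eq) (tabulate∘lookup v))

minimum : ∀ {n} (f : Vector ℕ (suc n)) → ∃ λ m → ∀ i → f m ≤ f i
minimum {zero}  f = zero , λ { zero → ≤-refl }
minimum {suc n} f with minimum (f ∘ suc)
... | m , min with f zero ≤? f (suc m)
...   | yes p = zero , λ { zero → ≤-refl ; (suc i) → ≤-trans p (min i) }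
...   | no ¬p = suc m , λ { zero → <⇒≤ (≰⇒> ¬p) ; (suc i) → min i }

-- Cancels the common terms of two permutation sums that differ only in rows `zero` and `suc i`.
∑-two-terms : ∀ {n} (f g : Vector ℕ (suc n)) i →
  (∀ r → r ≢ i → f (suc r) ≡ g (suc r)) → ∑ f ≡ ∑ g →
  f zero + f (suc i) ≡ g zero + g (suc i)
∑-two-terms {suc n} f g i f≗g ∑f≡∑g = +-cancelʳ-≡ (rest g) _ _ (begin
  f zero + f (suc i) + rest g ≡⟨ cong (f zero + f (suc i) +_) (∑-cong agree) ⟨
  f zero + f (suc i) + rest f ≡⟨ split f ⟨
  ∑ f                         ≡⟨ ∑f≡∑g ⟩
  ∑ g                         ≡⟨ split g ⟩
  g zero + g (suc i) + rest g ∎)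
  where
  open ≡-Reasoning
  rest : Vector ℕ (suc (suc n)) → ℕ
  rest h = ∑ (removeAt (h ∘ suc) i)
  split : ∀ h → ∑ h ≡ h zero + h (suc i) + rest h
  split h = trans (cong (h zero +_) (sum-remove {i = i} (h ∘ suc)))
                  (sym (+-assoc (h zero) (h (suc i)) (rest h)))
  agree : ∀ r → f (suc (punchIn i r)) ≡ g (suc (punchIn i r))
  agree r = f≗g (punchIn i r) (punchInᵢ≢i i r)

transpose-fst : ∀ {n} (i j : Fin n) → transpose i j ⟨$⟩ʳ i ≡ j
transpose-fst i j rewrite dec-true (i Fin.≟ i) refl = refl

transpose-snd : ∀ {n} (i j : Fin n) → i ≢ j → transpose i j ⟨$⟩ʳ j ≡ i
transpose-snd i j i≢j
  rewrite dec-false (j Fin.≟ i) (i≢j ∘ sym) | dec-true (j Fin.≟ j) refl = refl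

transpose-other : ∀ {n} (i j r : Fin n) → r ≢ i → r ≢ j → transpose i j ⟨$⟩ʳ r ≡ r
transpose-other i j r r≢i r≢j
  rewrite dec-false (r Fin.≟ i) r≢i | dec-false (r Fin.≟ j) r≢j = refl

module _ {d N : ℕ} (B : Fin (suc d) → Fin (suc d) → ℕ)
  (B-sum : ∀ (σ : Permutation′ (suc d)) → ∑ (λ i → B i (σ ⟨$⟩ʳ i)) ≡ N) where

  corner : ∀ i j → B zero zero + B i j ≡ B zero j + B i zero
  corner zero    j       = +-comm (B zero zero) (B zero j)
  corner (suc i) zero    = refl
  -- σ and σ′ differ only in that one maps (0, i) to (0, j) and the other to (j, 0).
  corner (suc i) (suc j) = begin
    B zero zero + B (suc i) (suc j)
      ≡⟨ cong (λ k → B zero zero + B (suc i) (suc k)) (transpose-fst i j) ⟨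
    B zero (σ ⟨$⟩ʳ zero) + B (suc i) (σ ⟨$⟩ʳ suc i)
      ≡⟨ ∑-two-terms (λ r → B r (σ ⟨$⟩ʳ r)) (λ r → B r (σ′ ⟨$⟩ʳ r)) i agree
           (trans (B-sum σ) (sym (B-sum σ′))) ⟩
    B zero (σ ⟨$⟩ʳ suc i) + B (suc i) (σ′ ⟨$⟩ʳ suc i)
      ≡⟨ cong₂ (λ k l → B zero (suc k) + B (suc i) (σ ⟨$⟩ʳ l))
           (transpose-fst i j) (transpose-snd zero (suc i) λ ()) ⟩
    B zero (suc j) + B (suc i) zero ∎
    where
    open ≡-Reasoning
    σ σ′ : Permutation′ (suc d)
    σ  = lift₀ (transpose i j)
    σ′ = transpose zero (suc i) ∘ₚ σ
    agree : ∀ r → r ≢ i → B (suc r) (σ ⟨$⟩ʳ suc r) ≡ B (suc r) (σ′ ⟨$⟩ʳ suc r)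
    agree r r≢i = cong (λ l → B (suc r) (σ ⟨$⟩ʳ l))
      (sym (transpose-other zero (suc i) (suc r) (λ ()) (r≢i ∘ Fin.suc-injective)))

  -- Changes the reference row from `zero` to `m`: `corner` at (i, j) and at (m, j) are combined and
  -- `B zero zero` cancels.
  quadrangle : ∀ i j m → B i j + B m zero ≡ B i zero + B m j
  quadrangle i j m = +-cancelˡ-≡ (B zero zero) _ _ (begin
    B zero zero + (B i j + B m zero)  ≡⟨ +-assoc (B zero zero) _ _ ⟨
    B zero zero + B i j + B m zero    ≡⟨ cong (_+ B m zero) (corner i j) ⟩
    B zero j + B i zero + B m zero    ≡⟨ xy∙z≈y∙xz (B zero j) _ _ ⟩
    B i zero + (B zero j + B m zero)  ≡⟨ cong (B i zero +_) (corner m j) ⟨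
    B i zero + (B zero zero + B m j)  ≡⟨ x∙yz≈y∙xz (B i zero) (B zero zero) (B m j) ⟩
    B zero zero + (B i zero + B m j)  ∎)
    where open ≡-Reasoning

  -- Take for `m` a row whose entry in column `zero` is least. Then the differences B i 0 - B m 0
  -- are naturals, one of them is 0, and row `m` itself serves as `b`.
  rank-one : Σ[ a ∈ Vector ℕ (suc d) ] Σ[ b ∈ Vector ℕ (suc d) ]
    ((∃ λ m → a m ≡ 0) × (∀ i j → a i + b j ≡ B i j))
  rank-one with minimum (λ i → B i zero)
  ... | m , min = a , B m , (m , n∸n≡0 (B m zero)) , sums
    where
    open ≡-Reasoning
    a : Fin (suc d) → ℕ
    a i = B i zero ∸ B m zero
    sums : ∀ i j → a i + B m j ≡ B i j
    sums i j = +-cancelʳ-≡ (B m zero) _ _ (begin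
      a i + B m j + B m zero    ≡⟨ xy∙z≈xz∙y (a i) _ _ ⟩
      a i + B m zero + B m j    ≡⟨ cong (_+ B m j) (m∸n+n≡m (min i)) ⟩
      B i zero + B m j          ≡⟨ quadrangle i j m ⟨
      B i j + B m zero          ∎)

-- The bijection between normalised pairs and G-matrices.

toMatrix : ∀ {d N} → NormalPair d d N → Σ (Matrix d) (IsGMatrix N)
toMatrix (a , b , _ , a+b≡N) = (λ i j → pos (lookup a i + lookup b j)) , record
  { nonNegative = λ i j → ℤ.+≤+ z≤n
  ; permSum     = λ σ → trans
      (∑ℤ-pos (λ i → lookup a i + lookup b (σ ⟨$⟩ʳ i)))
      (cong pos (trans (∑-rank-one (lookup a) (lookup b) σ)
        (trans (cong₂ _+_ (∑-lookup a) (∑-lookup b)) a+b≡N)))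
  }

-- Nonnegative entries equal their absolute values, so the decomposition can be carried out over ℕ.
∣∣-permSum : ∀ {d N} {A : Matrix d} → IsGMatrix N A →
  ∀ (σ : Permutation′ d) → ∑ (λ i → ∣ A i (σ ⟨$⟩ʳ i) ∣) ≡ N
∣∣-permSum {A = A} isG σ = ℤ.+-injective (trans (sym (∑ℤ-pos (λ i → ∣ A i (σ ⟨$⟩ʳ i) ∣)))
  (trans (∑ℤ-cong (λ i → ℤ.0≤i⇒+∣i∣≡i (nonNegative i (σ ⟨$⟩ʳ i)))) (permSum σ)))
  where open IsGMatrix isG

-- Evaluating a + b ≡ a′ + b′ in a row where a′ vanishes gives b′ ≥ b.
rank-one-≤ : ∀ {m n} (a a′ : Vector ℕ m) (b b′ : Vector ℕ n) →
  (∃ λ i → a′ i ≡ 0) → (∀ i j → a i + b j ≡ a′ i + b′ j) → ∀ j → b j ≤ b′ j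
rank-one-≤ a a′ b b′ (i , a′i≡0) eq j = begin
  b j         ≤⟨ m≤n+m (b j) (a i) ⟩
  a i + b j   ≡⟨ eq i j ⟩
  a′ i + b′ j ≡⟨ cong (_+ b′ j) a′i≡0 ⟩
  b′ j        ∎
  where open ≤-Reasoning

NormalPair⤖GMatrix : ∀ d N →
  Bijection (setoid (NormalPair (suc d) (suc d) N)) (gMatrixSetoid (suc d) N)
NormalPair⤖GMatrix d N = record
  { to        = toMatrix
  ; cong      = λ { refl _ _ → refl }
  ; bijective = injective , surjective
  }
  where
  injective : ∀ {x y : NormalPair (suc d) (suc d) N} →
    (∀ i j → proj₁ (toMatrix x) i j ≡ proj₁ (toMatrix y) i j) → x ≡ y
  injective {a , b , z , _} {a′ , b′ , z′ , _} eq =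
    NormalPair-≡ (lookup-injective a a′ a≗a′) (lookup-injective b b′ b≗b′)
    where
    eqℕ : ∀ i j → lookup a i + lookup b j ≡ lookup a′ i + lookup b′ j
    eqℕ i j = ℤ.+-injective (eq i j)
    b≗b′ : ∀ j → lookup b j ≡ lookup b′ j
    -- Both `a` and `a′` have a zero entry, so the comparison applies in either direction.
    b≗b′ j = ≤-antisym
      (rank-one-≤ (lookup a) (lookup a′) (lookup b) (lookup b′) (product≡0⇒∃ a′ z′) eqℕ j)
      (rank-one-≤ (lookup a′) (lookup a) (lookup b′) (lookup b) (product≡0⇒∃ a z)
        (λ i j → sym (eqℕ i j)) j)
    a≗a′ : ∀ i → lookup a i ≡ lookup a′ i
    -- Any column would do; column `i` is at hand because the matrix is square.
    a≗a′ i = +-cancelʳ-≡ (lookup b i) _ _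
      (trans (eqℕ i i) (cong (lookup a′ i +_) (sym (b≗b′ i))))

  surjective : (A : Σ (Matrix (suc d)) (IsGMatrix N)) → ∃ λ x → ∀ {z} → z ≡ x →
    ∀ i j → proj₁ (toMatrix z) i j ≡ proj₁ A i j
  surjective (A , isG)
    with rank-one (λ i j → ∣ A i j ∣) (∣∣-permSum isG)
  ... | a , b , (m , am≡0) , a+b≡∣A∣ =
    (tabulate a , tabulate b , zero-a , sum-a+b) , λ { refl i j → entry i j }
    where
    zero-a : product (tabulate a) ≡ 0
    zero-a = ∃⇒product≡0 (tabulate a) m
      (trans (lookup∘tabulate a m) am≡0)
    -- The identity permutation reveals the total: on the diagonal each a i and each b i occurs
    -- once.
    sum-a+b : sum (tabulate a) + sum (tabulate b) ≡ N
    sum-a+b = begin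
      sum (tabulate a) + sum (tabulate b) ≡⟨ cong₂ _+_ (sum-tabulate a) (sum-tabulate b) ⟩
      ∑ a + ∑ b                                   ≡⟨ ∑-distrib-+ a b ⟨
      ∑ (λ i → a i + b i)                         ≡⟨ ∑-cong (λ i → a+b≡∣A∣ i i) ⟩
      ∑ (λ i → ∣ A i i ∣)                         ≡⟨ ∣∣-permSum isG idₚ ⟩
      N                                           ∎
      where open ≡-Reasoning
    entry : ∀ i j → pos (lookup (tabulate a) i + lookup (tabulate b) j) ≡ A i j
    entry i j = trans
      (cong pos (trans (cong₂ _+_ (lookup∘tabulate a i) (lookup∘tabulate b j)) (a+b≡∣A∣ i j)))
      (ℤ.0≤i⇒+∣i∣≡i (IsGMatrix.nonNegative isG i j))

-- As i ≤ m ≤ k, the upper index N + k ∸ i equals N + (k ∸ i), a shift of `N` by a constant; each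
-- summand is thus a binomial polynomial of degree `k`.
count-PositivePolynomial : ∀ m k → m ≤ k → PositivePolynomial k (count (suc m) k)
count-PositivePolynomial m k m≤k =
  PositivePolynomial-resp (λ N → sym (count-closed (suc m) k N (s≤s m≤k)))
    (PositivePolynomial-∑ m _ λ i → PositivePolynomial-resp
      (λ N → cong (_C k) (sym (+-∸-assoc N (≤-trans (≤-pred (toℕ<n i)) m≤k))))
      (C-PositivePolynomial k (k ∸ toℕ i)))

mainTheorem2 : ∀ (d : ℕ) → 1 ≤ d →
    Σ[ g ∈ (ℕ → ℕ) ] (CountsGMatrices d g × IsPolynomialOfDegree (2 * d ∸ 2) g)
mainTheorem2 (suc m) _ = count (suc m) k ,
  (λ N → bijection (↔⇒⤖ (|NormalPair| (suc m) k N size)) (NormalPair⤖GMatrix m N)) ,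
  PositivePolynomial⇒IsPolynomialOfDegree
    (count-PositivePolynomial m k (subst (m ≤_) (sym k≡m+m) (m≤m+n m m)))
  where
  -- With d = m + 1 the pair has 2 d = k + 2 entries, of which k + 1 stay free once the first zero
  -- of `a` is located. For d = 1 this gives k = 0.
  k = 2 * suc m ∸ 2
  k≡m+m : k ≡ m + m
  k≡m+m = trans (cong (_∸ 1) (+-suc m (m + 0))) (cong (m +_) (+-identityʳ m))
  size : suc m + suc m ≡ suc (suc k)
  size = cong suc (trans (+-suc m m) (cong suc (sym k≡m+m)))
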